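{- For every integer $n\ge 16$, \[ av_{opt}(n)\ \ge\ n+\frac{n}{16\log_2 n}-\frac32 . \]
   Context: A stack of $n$ burnt pancakes is a pair $C=(\pi,v)$ with $\pi\in S_n$ and $v\in\{0,1\}^n$: the $i$-th pancake from the top has size $\pi(i)$ and lies burnt side down if $v_i=0$, burnt side up if $v_i=1$. An $i$-flip reverses the order of the top $i$ pancakes and switches the orientation of each of them. $I_n$ is the stack with pancakes $1,\dots,n$ from top to bottom, all burnt side down. $g(C)$ is the minimum number of flips needed to transform $C$ into $I_n$. $av_{opt}(n)$ is the average of $g(C)$ over all $n!\,2^n$ stacks $C$ of $n$ burnt pancakes, i.e. the average number of flips of an optimal sorting algorithm. -}

module Defs where

open import Data.Nat using (ℕ; zero; suc; _+_; _*_; _^_; _≤_; _!)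
open import Data.Nat.ListAction using (sum)
open import Data.Bool.ListAction using (all)
open import Data.Bool using (Bool; true; false; not; _∧_; T)
open import Data.Fin using (Fin; toℕ; _≟_)
open import Data.Product using (_×_; _,_; proj₁; proj₂; ∃)
open import Data.List using (List; []; _∷_; map; reverse; take; drop; _++_; length; allFin; cartesianProduct; filterᵇ; concatMap)
open import Data.Vec using (Vec; toList; tabulate)
import Data.Vec as V
open import Relation.Nullary using (does)
open import Relation.Binary.PropositionalEquality using (_≡_)

-- A pancake: (size, orientation).  Size k ∈ Fin n stands for the pancake of
-- size k+1.  Orientation false = burnt side down (v_i = 0), true = burnt side up.
Pancake : ℕ → Set
Pancake n = Fin n × Bool

-- A stack of n burnt pancakes, listed from top (index 0) to bottom.
-- Valid stacks are those whose sizes form a permutation (see isStack).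
Stack : ℕ → Set
Stack n = Vec (Pancake n) n

flipTop : ∀ {n} → ℕ → List (Pancake n) → List (Pancake n)
flipTop i xs = map (λ p → proj₁ p , not (proj₂ p)) (reverse (take i xs)) ++ drop i xs

applyFlips : ∀ {n} → List (Fin n) → List (Pancake n) → List (Pancake n)
applyFlips []       xs = xs
applyFlips (j ∷ fs) xs = applyFlips fs (flipTop (suc (toℕ j)) xs)

identityStack : (n : ℕ) → Stack n
identityStack n = tabulate (λ i → i , false)

SortableIn : ∀ {n} → ℕ → Stack n → Set
SortableIn {n} k C =
  ∃ λ (fs : List (Fin n)) → (length fs ≡ k) × (applyFlips fs (toList C) ≡ toList (identityStack n))

distinct : ∀ {n} → List (Pancake n) → Bool
distinct []       = true
distinct (p ∷ ps) = all (λ q → not (does (proj₁ p ≟ proj₁ q))) ps ∧ distinct ps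

IsOptimalFlipCount : ∀ n → (Stack n → ℕ) → Set
IsOptimalFlipCount n g =
  ∀ (C : Stack n) → T (distinct (toList C)) →
    SortableIn (g C) C × (∀ k → SortableIn k C → g C ≤ k)

allVecs : ∀ {A : Set} → List A → (k : ℕ) → List (Vec A k)
allVecs xs zero    = V.[] ∷ []
allVecs xs (suc k) = concatMap (λ x → map (x V.∷_) (allVecs xs k)) xs

allStacks : (n : ℕ) → List (Stack n)
allStacks n = filterᵇ (λ C → distinct (toList C))
                      (allVecs (cartesianProduct (allFin n) (true ∷ false ∷ [])) n)

-- total number of flips over all stacks (numerator of av_opt(n))
totalFlips : ∀ n → (Stack n → ℕ) → ℕ
totalFlips n g = sum (map g (allStacks n))

-- The real inequality  S/N ≥ n + n/(16 log₂ n) − 3/2  (N = n! 2^n, n ≥ 16)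
-- encoded exactly in ℕ: with p = 2S + 3N − 2nN, q = 2N it is equivalent to
-- n^(16p) ≥ 2^(nq), i.e.  2^(2nN) · n^(32nN) ≤ n^(16(2S+3N)).
AvOptBound : ℕ → ℕ → Set
AvOptBound n S = 2 ^ (2 * n * N) * n ^ (32 * n * N) ≤ n ^ (16 * (2 * S + 3 * N))
  where N = n ! * 2 ^ n

-- A bond is a pair of touching pancakes that also occurs, as it is or turned over, in the sorted stack.  A flip
-- changes the number of bonds by at most one, and the sorted stack has n − 1 of them, so sorting C takes
-- n − 1 − bonds(C) + w flips, where w ≥ 0 measures the waste.  On average a stack has at most 1/2 bond.
--
-- Run backwards from the sorted stack, a waste-free sequence destroys a bond at each step, so there are at most
-- about n! of them; each unit of waste costs at most a factor polynomial in n.  Since there are n! 2ⁿ stacks, at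
-- least half of them have waste of order n / log n.
module Submission where

open import Defs
open import Data.Bool using (Bool; true; false; not; _∧_; T; if_then_else_)
import Data.Bool as Bool
open import Data.Bool.ListAction using (all)
open import Data.Fin using (Fin; zero; suc; toℕ; inject₁; _≟_)
open import Data.Fin.Properties using (toℕ<n; toℕ-inject₁)
open import Data.List using (List; []; _∷_; [_]; _∷ʳ_; map; reverse; take; drop; _++_; length; allFin; cartesianProduct; filterᵇ; concatMap)
open import Data.List.Membership.Propositional using (_∈_; lose)
open import Data.List.Membership.Propositional.Properties using (∈-allFin; ∈-concatMap⁺)
open import Data.List.Properties hiding (sum-++)
open import Data.List.Relation.Unary.Any using (here; there)
open import Data.Nat using (ℕ; zero; suc; _+_; _*_; _^_; _≤_; _<_; _≤?_; _≤ᵇ_; _≡ᵇ_; _!; z≤n; s≤s; s≤s⁻¹; NonZero; >-nonZero)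
open import Data.Nat.ListAction using (sum)
open import Data.Nat.ListAction.Properties using (sum-++)
open import Data.Nat.Properties hiding (_≟_; _≤?_)
open import Data.Nat.Tactic.RingSolver using (solve-∀)
open import Data.Product using (_×_; _,_; proj₁; proj₂; ∃)
open import Data.Sum using (inj₁; inj₂)
open import Data.Vec using (Vec; toList; tabulate)
import Data.Vec as V
open import Data.Vec.Properties using (length-toList)
open import Function using (_∘_; id)
open import Relation.Nullary using (does; yes; no; contradiction)
open import Relation.Nullary.Decidable using (dec-true)
open import Relation.Binary.PropositionalEquality using (_≡_; refl; sym; trans; cong; cong₂; subst; subst₂)

private
  variable
    A A′ : Set
    n : ℕ

-- Sums over lists and 0/1 indicators.

*-swapˡ : ∀ a b c → a * (b * c) ≡ b * (a * c)
*-swapˡ = solve-∀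

∑ : List A → (A → ℕ) → ℕ
∑ xs f = sum (map f xs)

⟦_⟧ : Bool → ℕ
⟦ b ⟧ = if b then 1 else 0

⟦⟧≤1 : ∀ b → ⟦ b ⟧ ≤ 1
⟦⟧≤1 true  = ≤-refl
⟦⟧≤1 false = z≤n

⟦⟧-T : ∀ {b} → T b → ⟦ b ⟧ ≡ 1
⟦⟧-T {true} _ = refl

⟦∧⟧ : ∀ a b → ⟦ a ∧ b ⟧ ≡ ⟦ a ⟧ * ⟦ b ⟧
⟦∧⟧ true  b = sym (*-identityˡ ⟦ b ⟧)
⟦∧⟧ false b = refl

⟦⟧*-≤ : ∀ b m → ⟦ b ⟧ * m ≤ m
⟦⟧*-≤ true  m = ≤-reflexive (*-identityˡ m)
⟦⟧*-≤ false m = z≤n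

⟦⟧*-mono-≤ : ∀ b {k m} → (T b → k ≤ m) → ⟦ b ⟧ * k ≤ ⟦ b ⟧ * m
⟦⟧*-mono-≤ true  le = *-monoʳ-≤ 1 (le _)
⟦⟧*-mono-≤ false le = z≤n

⟦⟧*-cong : ∀ b {k m} → (T b → k ≡ m) → ⟦ b ⟧ * k ≡ ⟦ b ⟧ * m
⟦⟧*-cong true  eq = cong (1 *_) (eq _)
⟦⟧*-cong false eq = refl

∑-mono : ∀ (xs : List A) {f g} → (∀ x → f x ≤ g x) → ∑ xs f ≤ ∑ xs g
∑-mono []       le = z≤n
∑-mono (x ∷ xs) le = +-mono-≤ (le x) (∑-mono xs le)

∑-cong : ∀ (xs : List A) {f g} → (∀ x → f x ≡ g x) → ∑ xs f ≡ ∑ xs g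
∑-cong xs eq = cong sum (map-cong eq xs)

∑-+ : ∀ (xs : List A) f g → ∑ xs (λ x → f x + g x) ≡ ∑ xs f + ∑ xs g
∑-+ []       f g = refl
∑-+ (x ∷ xs) f g = trans (cong (f x + g x +_) (∑-+ xs f g)) (+-interchange (f x) (g x) _ _)
  where
  +-interchange : ∀ a b c d → a + b + (c + d) ≡ a + c + (b + d)
  +-interchange = solve-∀

∑-*ʳ : ∀ (xs : List A) f c → ∑ xs (λ x → f x * c) ≡ ∑ xs f * c
∑-*ʳ []       f c = refl
∑-*ʳ (x ∷ xs) f c = trans (cong (f x * c +_) (∑-*ʳ xs f c)) (sym (*-distribʳ-+ c (f x) _))

∑-*ˡ : ∀ (xs : List A) c f → ∑ xs (λ x → c * f x) ≡ c * ∑ xs f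
∑-*ˡ xs c f = trans (∑-cong xs (λ x → *-comm c (f x))) (trans (∑-*ʳ xs f c) (*-comm _ c))

∑-const : ∀ (xs : List A) c → ∑ xs (λ _ → c) ≡ length xs * c
∑-const []       c = refl
∑-const (x ∷ xs) c = cong (c +_) (∑-const xs c)

∑-zero : ∀ (xs : List A) → ∑ xs (λ _ → 0) ≡ 0
∑-zero xs = trans (∑-const xs 0) (*-zeroʳ (length xs))

∑-++ : ∀ (xs ys : List A) f → ∑ (xs ++ ys) f ≡ ∑ xs f + ∑ ys f
∑-++ xs ys f = trans (cong sum (map-++ f xs ys)) (sum-++ (map f xs) (map f ys))

∑-map : ∀ (h : A′ → A) xs f → ∑ (map h xs) f ≡ ∑ xs (f ∘ h)
∑-map h xs f = cong sum (sym (map-∘ xs))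

∑-concatMap : ∀ (h : A′ → List A) xs f → ∑ (concatMap h xs) f ≡ ∑ xs (λ x → ∑ (h x) f)
∑-concatMap h []       f = refl
∑-concatMap h (x ∷ xs) f =
  trans (∑-++ (h x) (concatMap h xs) f) (cong (∑ (h x) f +_) (∑-concatMap h xs f))

∑-cartesianProduct : ∀ (xs : List A) (ys : List A′) f →
  ∑ (cartesianProduct xs ys) f ≡ ∑ xs (λ x → ∑ ys (λ y → f (x , y)))
∑-cartesianProduct []       ys f = refl
∑-cartesianProduct (x ∷ xs) ys f =
  trans (∑-++ (map (x ,_) ys) _ f) (cong₂ _+_ (∑-map (x ,_) ys f) (∑-cartesianProduct xs ys f))

∑-filterᵇ : ∀ (p : A → Bool) xs f → ∑ (filterᵇ p xs) f ≡ ∑ xs (λ x → ⟦ p x ⟧ * f x)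
∑-filterᵇ p []       f = refl
∑-filterᵇ p (x ∷ xs) f with p x
... | true  = cong₂ _+_ (sym (*-identityˡ (f x))) (∑-filterᵇ p xs f)
... | false = ∑-filterᵇ p xs f

∑-swap : ∀ (xs : List A) (ys : List A′) (f : A → A′ → ℕ) →
  ∑ xs (λ x → ∑ ys (λ y → f x y)) ≡ ∑ ys (λ y → ∑ xs (λ x → f x y))
∑-swap []       ys f = sym (∑-zero ys)
∑-swap (x ∷ xs) ys f = trans (cong (∑ ys (f x) +_) (∑-swap xs ys f)) (sym (∑-+ ys (f x) (λ y → ∑ xs (λ x → f x y))))

∑-∈ : ∀ {x : A} {xs} f → x ∈ xs → f x ≤ ∑ xs f
∑-∈ f (here refl)            = m≤m+n _ _
∑-∈ {xs = y ∷ _} f (there p) = ≤-trans (∑-∈ f p) (m≤n+m _ (f y))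

length-∑ : ∀ (xs : List A) → length xs ≡ ∑ xs (λ _ → 1)
length-∑ xs = sym (trans (∑-const xs 1) (*-identityʳ _))

length-concatMap : ∀ (h : A′ → List A) xs → length (concatMap h xs) ≡ ∑ xs (length ∘ h)
length-concatMap h xs = trans (length-∑ (concatMap h xs))
  (trans (∑-concatMap h xs _) (∑-cong xs (λ x → sym (length-∑ (h x)))))

∑-allFin-suc : ∀ n (f : Fin (suc n) → ℕ) → ∑ (allFin (suc n)) f ≡ f zero + ∑ (allFin n) (f ∘ suc)
∑-allFin-suc n f = cong (λ ys → f zero + sum ys) (trans (map-tabulate suc f) (sym (map-tabulate id (f ∘ suc))))

∑-allFin-const : ∀ n c → ∑ (allFin n) (λ _ → c) ≡ n * c
∑-allFin-const n c = trans (∑-const (allFin n) c) (cong (_* c) (length-tabulate (id {A = Fin n})))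

∑-allFin-≟ : ∀ (i : Fin n) → ∑ (allFin n) (λ j → ⟦ does (j ≟ i) ⟧) ≡ 1
∑-allFin-≟ {suc n} zero    =
  trans (∑-allFin-suc n (λ j → ⟦ does (j ≟ zero) ⟧)) (cong suc (∑-zero (allFin n)))
∑-allFin-≟ {suc n} (suc i) =
  trans (∑-allFin-suc n (λ j → ⟦ does (j ≟ suc i) ⟧)) (∑-allFin-≟ i)

-- Only `≤`, since `c` may lie outside `0, …, n − 1`: the largest pancake has no successor to bond
-- with.
∑-allFin-≡ᵇ : ∀ n c → ∑ (allFin n) (λ j → ⟦ c ≡ᵇ toℕ j ⟧) ≤ 1
∑-allFin-≡ᵇ zero    c       = z≤n
∑-allFin-≡ᵇ (suc n) zero    = ≤-reflexive
  (trans (∑-allFin-suc n (λ j → ⟦ 0 ≡ᵇ toℕ j ⟧)) (cong suc (∑-zero (allFin n))))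
∑-allFin-≡ᵇ (suc n) (suc c) = ≤-trans
  (≤-reflexive (∑-allFin-suc n (λ j → ⟦ suc c ≡ᵇ toℕ j ⟧))) (∑-allFin-≡ᵇ n c)

≡ᵇ-sym : ∀ a b → (a ≡ᵇ b) ≡ (b ≡ᵇ a)
≡ᵇ-sym zero    zero    = refl
≡ᵇ-sym zero    (suc b) = refl
≡ᵇ-sym (suc a) zero    = refl
≡ᵇ-sym (suc a) (suc b) = ≡ᵇ-sym a b

∑-allFin-suc≡ᵇ : ∀ n c → ∑ (allFin n) (λ j → ⟦ suc (toℕ j) ≡ᵇ c ⟧) ≤ 1
∑-allFin-suc≡ᵇ n zero    = ≤-trans (≤-reflexive (∑-zero (allFin n))) z≤n
∑-allFin-suc≡ᵇ n (suc c) = ≤-trans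
  (≤-reflexive (∑-cong (allFin n) (λ j → cong ⟦_⟧ (≡ᵇ-sym (toℕ j) c)))) (∑-allFin-≡ᵇ n c)

-- Counting lists of pancakes of distinct sizes.

pancakes : ∀ n → List (Pancake n)
pancakes n = cartesianProduct (allFin n) (true ∷ false ∷ [])

∑-pancakes : ∀ (f : Pancake n → ℕ) →
  ∑ (pancakes n) f ≡ ∑ (allFin n) (λ i → f (i , true) + f (i , false))
∑-pancakes {n} f = trans (∑-cartesianProduct (allFin n) _ f)
  (∑-cong (allFin n) (λ i → cong (f (i , true) +_) (+-identityʳ (f (i , false)))))

∑-pancakes-const : ∀ n c → ∑ (pancakes n) (λ _ → c) ≡ 2 * n * c
∑-pancakes-const n c = trans (∑-pancakes {n} (λ _ → c)) (trans (∑-allFin-const n (c + c)) (regroup n c))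
  where
  regroup : ∀ n c → n * (c + c) ≡ 2 * n * c
  regroup = solve-∀

∑-allVecs-suc : ∀ (xs : List A) k (f : Vec A (suc k) → ℕ) →
  ∑ (allVecs xs (suc k)) f ≡ ∑ xs (λ x → ∑ (allVecs xs k) (λ v → f (x V.∷ v)))
∑-allVecs-suc xs k f = trans (∑-concatMap _ xs f) (∑-cong xs (λ x → ∑-map (x V.∷_) (allVecs xs k) f))

sameSize : Pancake n → Pancake n → Bool
sameSize p q = does (proj₁ p ≟ proj₁ q)

fresh : Pancake n → List (Pancake n) → Bool
fresh p = all (λ q → not (sameSize p q))

sameSize-≡ : ∀ {p q : Pancake n} → T (sameSize p q) → proj₁ p ≡ proj₁ q
sameSize-≡ {p = p} {q} t with proj₁ p ≟ proj₁ q
... | yes eq = eq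

sameSize-sym : ∀ (p q : Pancake n) → sameSize p q ≡ sameSize q p
sameSize-sym p q with proj₁ p ≟ proj₁ q
... | yes eq = sym (dec-true (proj₁ q ≟ proj₁ p) (sym eq))
... | no neq with proj₁ q ≟ proj₁ p
...   | yes eq = contradiction (sym eq) neq
...   | no _   = refl

fresh-sameSize : ∀ {p q : Pancake n} us → T (sameSize p q) → fresh p us ≡ fresh q us
fresh-sameSize {p = p} {q} us t =
  cong (λ i → all (λ r → not (does (i ≟ proj₁ r))) us) (sameSize-≡ {p = p} {q} t)

T-∧ˡ : ∀ {a b} → T (a ∧ b) → T a
T-∧ˡ {true} _ = _

T-∧ʳ : ∀ {a b} → T (a ∧ b) → T b
T-∧ʳ {true} t = t

∑-sameSize : ∀ (u : Pancake n) → ∑ (pancakes n) (λ z → ⟦ sameSize z u ⟧) ≡ 2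
∑-sameSize {n} u = begin-equality
  ∑ (pancakes n) (λ z → ⟦ sameSize z u ⟧)  ≡⟨ ∑-pancakes {n} _ ⟩
  ∑ (allFin n) (λ i → same i + same i)      ≡⟨ ∑-+ (allFin n) same same ⟩
  ∑ (allFin n) same + ∑ (allFin n) same      ≡⟨ cong₂ _+_ one one ⟩
  2                                          ∎
  where
  open ≤-Reasoning
  same : Fin n → ℕ
  same i = ⟦ does (i ≟ proj₁ u) ⟧
  one = ∑-allFin-≟ (proj₁ u)

-- Each pancake of `us` rules out both orientations of its size, and `distinct us` keeps these pairs
-- disjoint. The additive form avoids truncated subtraction.
∑-fresh : ∀ (us : List (Pancake n)) → T (distinct us) →
  ∑ (pancakes n) (λ z → ⟦ fresh z us ⟧) + 2 * length us ≡ 2 * n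
∑-fresh {n} []       d = trans (+-identityʳ _) (trans (∑-pancakes-const n 1) (*-identityʳ _))
∑-fresh {n} (u ∷ us) d = begin-equality
  F (u ∷ us) + 2 * suc (length us)                  ≡⟨ regroup (F (u ∷ us)) (length us) ⟩
  F (u ∷ us) + 2 + 2 * length us                    ≡⟨ cong (λ t → F (u ∷ us) + t + 2 * length us) (sym (∑-sameSize u)) ⟩
  F (u ∷ us) + ∑ (pancakes n) same + 2 * length us  ≡⟨ cong (_+ 2 * length us) (sym (∑-+ (pancakes n) _ same)) ⟩
  ∑ (pancakes n) (λ z → ⟦ fresh z (u ∷ us) ⟧ + same z) + 2 * length us
    ≡⟨ cong (_+ 2 * length us) (∑-cong (pancakes n) split) ⟩
  F us + 2 * length us                              ≡⟨ ∑-fresh us (T-∧ʳ {fresh u us} d) ⟩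
  2 * n                                             ∎
  where
  open ≤-Reasoning
  F : List (Pancake n) → ℕ
  F vs = ∑ (pancakes n) (λ z → ⟦ fresh z vs ⟧)
  same : Pancake n → ℕ
  same z = ⟦ sameSize z u ⟧
  regroup : ∀ a l → a + 2 * suc l ≡ a + 2 + 2 * l
  regroup = solve-∀
  aux : ∀ c f → (T c → T f) → ⟦ not c ∧ f ⟧ + ⟦ c ⟧ ≡ ⟦ f ⟧
  aux true  f imp = sym (⟦⟧-T (imp _))
  aux false f imp = +-identityʳ _
  split : ∀ z → ⟦ fresh z (u ∷ us) ⟧ + same z ≡ ⟦ fresh z us ⟧
  -- A `z` of the size of `u` is fresh for `us` because `u` is, so passing to `u ∷ us` loses both
  -- pancakes of that size.
  split z = aux (sameSize z u) (fresh z us)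
    (λ t → subst T (sym (fresh-sameSize {p = z} {u} us t)) (T-∧ˡ d))

∧-shuffle : ∀ a b c d → (a ∧ (c ∧ true)) ∧ (b ∧ d) ≡ (c ∧ b) ∧ (a ∧ d)
∧-shuffle false false false d = refl
∧-shuffle false false true  d = refl
∧-shuffle false true  false d = refl
∧-shuffle false true  true  d = refl
∧-shuffle true  false false d = refl
∧-shuffle true  false true  d = refl
∧-shuffle true  true  false d = refl
∧-shuffle true  true  true  d = refl

all-++ : ∀ (p : A → Bool) xs ys → all p (xs ++ ys) ≡ all p xs ∧ all p ys
all-++ p []       ys = refl
all-++ p (x ∷ xs) ys with p x
... | true  = all-++ p xs ys
... | false = refl

-- The prefix in `∑-distinct-++` grows at its end, while `distinct` recurses from the front; the
-- symmetry of `sameSize` reconciles the two.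
distinct-∷ʳ : ∀ (us : List (Pancake n)) z → distinct (us ∷ʳ z) ≡ distinct (z ∷ us)
distinct-∷ʳ []       z = refl
distinct-∷ʳ (u ∷ us) z
  rewrite all-++ (λ q → not (sameSize u q)) us [ z ] | distinct-∷ʳ us z | sameSize-sym u z =
  ∧-shuffle (fresh u us) (fresh z us) (not (sameSize z u)) (distinct us)

-- 2(s+1) · 2(s+2) ⋯ 2(s+k): the number of ways to extend a stack by k pancakes when s + k sizes are unused.
extensions : ℕ → ℕ → ℕ
extensions zero    s = 1
extensions (suc k) s = 2 * suc (k + s) * extensions k s

extensions-zero : ∀ k → extensions k 0 ≡ k ! * 2 ^ k
extensions-zero zero = refl
extensions-zero (suc k) rewrite extensions-zero k | +-identityʳ k = regroup k (k !) (2 ^ k)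
  where
  regroup : ∀ k f t → 2 * suc k * (f * t) ≡ suc k * f * (2 * t)
  regroup = solve-∀

∑-distinct-∷ : ∀ r (us : List (Pancake n)) → length us + r ≡ n →
  ∑ (pancakes n) (λ z → ⟦ distinct (z ∷ us) ⟧) ≡ ⟦ distinct us ⟧ * (2 * r)
∑-distinct-∷ {n} r us eq = begin-equality
  ∑ (pancakes n) (λ z → ⟦ fresh z us ∧ distinct us ⟧)    ≡⟨ ∑-cong (pancakes n) (λ z → ⟦∧⟧ (fresh z us) (distinct us)) ⟩
  ∑ (pancakes n) (λ z → ⟦ fresh z us ⟧ * ⟦ distinct us ⟧) ≡⟨ ∑-*ʳ (pancakes n) _ _ ⟩
  ∑ (pancakes n) (λ z → ⟦ fresh z us ⟧) * ⟦ distinct us ⟧ ≡⟨ *-comm _ ⟦ distinct us ⟧ ⟩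
  ⟦ distinct us ⟧ * ∑ (pancakes n) (λ z → ⟦ fresh z us ⟧) ≡⟨ ⟦⟧*-cong (distinct us) (λ d → +-cancelʳ-≡ (2 * length us) _ _ (count d)) ⟩
  ⟦ distinct us ⟧ * (2 * r)                               ∎
  where
  open ≤-Reasoning
  regroup : ∀ l r → 2 * (l + r) ≡ 2 * r + 2 * l
  regroup = solve-∀
  count : T (distinct us) → ∑ (pancakes n) (λ z → ⟦ fresh z us ⟧) + 2 * length us ≡ 2 * r + 2 * length us
  count d = trans (∑-fresh us d) (trans (cong (2 *_) (sym eq)) (regroup (length us) r))

∑-distinct-++ : ∀ k s (us : List (Pancake n)) → length us + (k + s) ≡ n →
  ∑ (allVecs (pancakes n) k) (λ v → ⟦ distinct (us ++ toList v) ⟧) ≡ ⟦ distinct us ⟧ * extensions k s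
∑-distinct-++ zero s us eq rewrite ++-identityʳ us = trans (+-identityʳ _) (sym (*-identityʳ _))
∑-distinct-++ {n} (suc k) s us eq = begin-equality
  ∑ (allVecs (pancakes n) (suc k)) (λ v → ⟦ distinct (us ++ toList v) ⟧)
    ≡⟨ ∑-allVecs-suc (pancakes n) k _ ⟩
  ∑ (pancakes n) (λ z → ∑ (allVecs (pancakes n) k) (λ v → ⟦ distinct (us ++ z ∷ toList v) ⟧))
    ≡⟨ ∑-cong (pancakes n) step ⟩
  ∑ (pancakes n) (λ z → ⟦ distinct (z ∷ us) ⟧ * extensions k s)
    ≡⟨ ∑-*ʳ (pancakes n) _ _ ⟩
  ∑ (pancakes n) (λ z → ⟦ distinct (z ∷ us) ⟧) * extensions k s
    ≡⟨ cong (_* extensions k s) (∑-distinct-∷ (suc (k + s)) us eq) ⟩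
  ⟦ distinct us ⟧ * (2 * suc (k + s)) * extensions k s
    ≡⟨ *-assoc ⟦ distinct us ⟧ (2 * suc (k + s)) (extensions k s) ⟩
  ⟦ distinct us ⟧ * extensions (suc k) s ∎
  where
  open ≤-Reasoning
  len : ∀ z → length (us ∷ʳ z) + (k + s) ≡ n
  len z = trans (cong (_+ (k + s)) (length-++ us)) (trans (+-assoc (length us) 1 (k + s)) eq)
  step : ∀ z → ∑ (allVecs (pancakes n) k) (λ v → ⟦ distinct (us ++ z ∷ toList v) ⟧)
             ≡ ⟦ distinct (z ∷ us) ⟧ * extensions k s
  step z = trans
    (∑-cong (allVecs (pancakes n) k) (λ v → cong (λ w → ⟦ distinct w ⟧) (sym (++-assoc us [ z ] (toList v)))))
    (trans (∑-distinct-++ k s (us ∷ʳ z) (len z)) (cong (λ b → ⟦ b ⟧ * extensions k s) (distinct-∷ʳ us z)))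

∑-distinct : ∀ k s → k + s ≡ n →
  ∑ (allVecs (pancakes n) k) (λ v → ⟦ distinct (toList v) ⟧) ≡ extensions k s
∑-distinct k s eq = trans (∑-distinct-++ k s [] eq) (*-identityˡ _)

-- The product peeled at its smallest factor instead of its largest, as needed when a pancake is put
-- on top of a stack chosen before it.
extensions-suc : ∀ k s → 2 * suc s * extensions k (suc s) ≡ extensions (suc k) s
extensions-suc zero    s = refl
extensions-suc (suc k) s rewrite +-suc k s =
  trans (*-swapˡ (2 * suc s) (2 * suc (suc (k + s))) (extensions k (suc s)))
        (cong (2 * suc (suc (k + s)) *_) (extensions-suc k s))

-- Bonds and their average number.

-- The bottom pancake is not compared with the plate, so the sorted stack has n − 1 bonds.
adjacent : Pancake n → Pancake n → ℕ
adjacent (p , false) (q , false) = ⟦ suc (toℕ p) ≡ᵇ toℕ q ⟧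
adjacent (p , true)  (q , true)  = ⟦ suc (toℕ q) ≡ᵇ toℕ p ⟧
adjacent _           _           = 0

bondOnto : Pancake n → List (Pancake n) → ℕ
bondOnto x []      = 0
bondOnto x (y ∷ _) = adjacent x y

bonds : List (Pancake n) → ℕ
bonds []       = 0
bonds (x ∷ xs) = bondOnto x xs + bonds xs

-- The upper pancake of a bond determines the lower one in size and orientation: the next larger if
-- burnt side down, the next smaller if burnt side up.
∑-adjacent : ∀ (x : Pancake n) → ∑ (pancakes n) (adjacent x) ≤ 1
∑-adjacent {n} x@(p , false) = ≤-trans (≤-reflexive (∑-pancakes (adjacent x))) (∑-allFin-≡ᵇ n (suc (toℕ p)))
∑-adjacent {n} x@(p , true)  = ≤-trans (≤-reflexive (trans (∑-pancakes (adjacent x))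
  (∑-cong (allFin n) (λ q → +-identityʳ ⟦ suc (toℕ q) ≡ᵇ toℕ p ⟧)))) (∑-allFin-suc≡ᵇ n (toℕ p))

topBonds : ∀ n k → ℕ
topBonds n k = ∑ (pancakes n) λ x → ∑ (allVecs (pancakes n) k) λ v →
  ⟦ distinct (x ∷ toList v) ⟧ * bondOnto x (toList v)

totalBonds : ∀ n k → ℕ
totalBonds n k = ∑ (allVecs (pancakes n) k) λ v → ⟦ distinct (toList v) ⟧ * bonds (toList v)

topBonds-zero : ∀ n → topBonds n 0 ≡ 0
topBonds-zero n = ∑-zero (pancakes n)

-- The top `x` has `2 * n` choices, its partner `y` is then forced, and the remaining `k` pancakes
-- come from the `k + s` sizes left.
topBonds-suc-≤ : ∀ k s → suc (suc (k + s)) ≡ n → topBonds n (suc k) ≤ 2 * n * extensions k s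
topBonds-suc-≤ {n} k s eq = begin
  topBonds n (suc k)
    ≡⟨ ∑-cong P (λ x → ∑-allVecs-suc P k _) ⟩
  ∑ P (λ x → ∑ P (λ y → ∑ Vs (λ v → ⟦ distinct (x ∷ y ∷ toList v) ⟧ * adjacent x y)))
    ≡⟨ ∑-cong P (λ x → ∑-cong P (λ y → ∑-*ʳ Vs (λ v → ⟦ distinct (x ∷ y ∷ toList v) ⟧) (adjacent x y))) ⟩
  ∑ P (λ x → ∑ P (λ y → ∑ Vs (λ v → ⟦ distinct (x ∷ y ∷ toList v) ⟧) * adjacent x y))
    ≤⟨ ∑-mono P (λ x → ∑-mono P (λ y → *-monoˡ-≤ (adjacent x y) (rest x y))) ⟩
  ∑ P (λ x → ∑ P (λ y → extensions k s * adjacent x y))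
    ≡⟨ ∑-cong P (λ x → ∑-*ˡ P (extensions k s) (adjacent x)) ⟩
  ∑ P (λ x → extensions k s * ∑ P (adjacent x))
    ≤⟨ ∑-mono P (λ x → *-monoʳ-≤ (extensions k s) (∑-adjacent x)) ⟩
  ∑ P (λ x → extensions k s * 1)
    ≡⟨ ∑-pancakes-const n (extensions k s * 1) ⟩
  2 * n * (extensions k s * 1)
    ≡⟨ cong (2 * n *_) (*-identityʳ (extensions k s)) ⟩
  2 * n * extensions k s ∎
  where
  open ≤-Reasoning
  P = pancakes n
  Vs = allVecs P k
  rest : ∀ x y → ∑ Vs (λ v → ⟦ distinct (x ∷ y ∷ toList v) ⟧) ≤ extensions k s
  rest x y = ≤-trans (≤-reflexive (∑-distinct-++ k s (x ∷ y ∷ []) eq)) (⟦⟧*-≤ (distinct (x ∷ y ∷ [])) _)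

-- The topmost pair is counted apart. Every lower bond lies in a stack of `k` pancakes, which leaves
-- `suc s` sizes and hence `2 * suc s` choices for the new top.
totalBonds-suc : ∀ k s → suc k + s ≡ n →
  totalBonds n (suc k) ≡ topBonds n k + 2 * suc s * totalBonds n k
totalBonds-suc {n} k s eq = begin-equality
  totalBonds n (suc k)
    ≡⟨ ∑-allVecs-suc P k _ ⟩
  ∑ P (λ x → ∑ Vs (λ v → ⟦ distinct (x ∷ toList v) ⟧ * (bondOnto x (toList v) + bonds (toList v))))
    ≡⟨ ∑-cong P (λ x → trans (∑-cong Vs (λ v → *-distribˡ-+ ⟦ distinct (x ∷ toList v) ⟧ _ _)) (∑-+ Vs _ _)) ⟩
  ∑ P (λ x → ∑ Vs (λ v → ⟦ distinct (x ∷ toList v) ⟧ * bondOnto x (toList v))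
           + ∑ Vs (λ v → ⟦ distinct (x ∷ toList v) ⟧ * bonds (toList v)))
    ≡⟨ ∑-+ P _ _ ⟩
  topBonds n k + ∑ P (λ x → ∑ Vs (λ v → ⟦ distinct (x ∷ toList v) ⟧ * bonds (toList v)))
    ≡⟨ cong (topBonds n k +_) (∑-swap P Vs _) ⟩
  topBonds n k + ∑ Vs (λ v → ∑ P (λ x → ⟦ distinct (x ∷ toList v) ⟧ * bonds (toList v)))
    ≡⟨ cong (topBonds n k +_) (∑-cong Vs below) ⟩
  topBonds n k + ∑ Vs (λ v → 2 * suc s * (⟦ distinct (toList v) ⟧ * bonds (toList v)))
    ≡⟨ cong (topBonds n k +_) (∑-*ˡ Vs (2 * suc s) _) ⟩
  topBonds n k + 2 * suc s * totalBonds n k ∎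
  where
  open ≤-Reasoning
  P = pancakes n
  Vs = allVecs P k
  regroup : ∀ a b c → a * b * c ≡ b * (a * c)
  regroup = solve-∀
  below : ∀ v → ∑ P (λ x → ⟦ distinct (x ∷ toList v) ⟧ * bonds (toList v))
              ≡ 2 * suc s * (⟦ distinct (toList v) ⟧ * bonds (toList v))
  below v = trans (∑-*ʳ P _ (bonds (toList v)))
    (trans (cong (_* bonds (toList v)) (∑-distinct-∷ (suc s) (toList v)
              (trans (cong (_+ suc s) (length-toList v)) (trans (+-suc k s) eq))))
           (regroup ⟦ distinct (toList v) ⟧ (2 * suc s) (bonds (toList v))))

-- Linearity of expectation: `suc k` pancakes have `k` touching pairs, and each is a bond with
-- probability at most 1/(2m), the lower pancake being one of `2 * m` equally likely ones. The
-- number of lists is `extensions (suc k) s`.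
totalBonds-bound : ∀ m k s → k + s ≡ m → 2 * m * totalBonds (suc m) (suc k) ≤ k * extensions (suc k) s
totalBonds-bound m zero s refl = ≤-reflexive (trans
  (cong (2 * m *_) (trans (totalBonds-suc 0 s refl)
    (cong₂ _+_ (topBonds-zero (suc m)) (*-zeroʳ (2 * suc s))))) (*-zeroʳ (2 * m)))
totalBonds-bound m (suc k) s refl = begin
  2 * m * totalBonds (suc m) (suc (suc k))
    ≡⟨ cong (2 * m *_) (totalBonds-suc (suc k) s refl) ⟩
  2 * m * (topBonds (suc m) (suc k) + 2 * suc s * TB)
    ≡⟨ regroup (2 * m) (topBonds (suc m) (suc k)) (2 * suc s) TB ⟩
  2 * m * topBonds (suc m) (suc k) + 2 * suc s * (2 * m * TB)
    ≤⟨ +-mono-≤ (*-monoʳ-≤ (2 * m) (topBonds-suc-≤ k s refl))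
                (*-monoʳ-≤ (2 * suc s) (totalBonds-bound m k (suc s) (+-suc k s))) ⟩
  2 * m * (2 * suc m * extensions k s) + 2 * suc s * (k * extensions (suc k) (suc s))
    -- Here `m` is `suc k + s`, so `2 * suc m` and `2 * m` are the two top factors of
    -- `extensions (suc (suc k)) s`: the new pair adds one full share.
    ≡⟨ cong₂ _+_ (*-swapˡ (2 * m) (2 * suc m) (extensions k s)) (*-swapˡ (2 * suc s) k _) ⟩
  extensions (suc (suc k)) s + k * (2 * suc s * extensions (suc k) (suc s))
    ≡⟨ cong (λ t → extensions (suc (suc k)) s + k * t) (extensions-suc (suc k) s) ⟩
  suc k * extensions (suc (suc k)) s ∎
  where
  open ≤-Reasoning
  TB = totalBonds (suc m) (suc k)
  regroup : ∀ a b c d → a * (b + c * d) ≡ a * b + c * (a * d)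
  regroup = solve-∀

2*totalBonds≤ : ∀ m .{{_ : NonZero m}} → 2 * totalBonds (suc m) (suc m) ≤ suc m ! * 2 ^ suc m
2*totalBonds≤ m = *-cancelˡ-≤ m (begin
  m * (2 * totalBonds (suc m) (suc m))  ≡⟨ regroup m (totalBonds (suc m) (suc m)) ⟩
  2 * m * totalBonds (suc m) (suc m)    ≤⟨ totalBonds-bound m m 0 (+-identityʳ m) ⟩
  m * extensions (suc m) 0              ≡⟨ cong (m *_) (extensions-zero (suc m)) ⟩
  m * (suc m ! * 2 ^ suc m)             ∎)
  where
  open ≤-Reasoning
  regroup : ∀ a b → a * (2 * b) ≡ 2 * a * b
  regroup = solve-∀

-- Flips and their inverses.

turn : Pancake n → Pancake n
turn p = proj₁ p , not (proj₂ p)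

-- Turns a block over as a whole: `flipTop i xs` is by definition `mirror (take i xs) ++ drop i xs`.
mirror : List (Pancake n) → List (Pancake n)
mirror us = map turn (reverse us)

turn-involutive : ∀ (p : Pancake n) → turn (turn p) ≡ p
turn-involutive (i , true)  = refl
turn-involutive (i , false) = refl

mirror-∷ : ∀ (x : Pancake n) us → mirror (x ∷ us) ≡ mirror us ∷ʳ turn x
mirror-∷ x us = trans (cong (map turn) (unfold-reverse x us)) (map-++ turn (reverse us) [ x ])

mirror-involutive : ∀ (us : List (Pancake n)) → mirror (mirror us) ≡ us
mirror-involutive us =
  trans (cong (map turn) (trans (sym (reverse-map turn (reverse us))) (cong (map turn) (reverse-involutive us))))
        (trans (sym (map-∘ us)) (trans (map-cong turn-involutive us) (map-id us)))

length-mirror : ∀ (us : List (Pancake n)) → length (mirror us) ≡ length us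
length-mirror us = trans (length-map turn (reverse us)) (length-reverse us)

take-length-++ : ∀ (us vs : List A) → take (length us) (us ++ vs) ≡ us
take-length-++ []       vs = refl
take-length-++ (u ∷ us) vs = cong (u ∷_) (take-length-++ us vs)

drop-length-++ : ∀ (us vs : List A) → drop (length us) (us ++ vs) ≡ vs
drop-length-++ []       vs = refl
drop-length-++ (u ∷ us) vs = drop-length-++ us vs

length-flipTop : ∀ i (xs : List (Pancake n)) → length (flipTop i xs) ≡ length xs
length-flipTop i xs = trans (length-++ (mirror (take i xs)))
  (trans (cong (_+ length (drop i xs)) (length-mirror (take i xs)))
    (trans (sym (length-++ (take i xs))) (cong length (take++drop≡id i xs))))

-- The turned prefix again has length `i`, so the second flip cuts in the same place and undoes the
-- first.
flipTop-involutive : ∀ i (xs : List (Pancake n)) → i ≤ length xs → flipTop i (flipTop i xs) ≡ xs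
flipTop-involutive i xs i≤ = trans (cong₂ _++_ (trans (cong mirror top) (mirror-involutive (take i xs))) rest)
                                   (take++drop≡id i xs)
  where
  ms = mirror (take i xs)
  len : length ms ≡ i
  len = trans (length-mirror (take i xs)) (trans (length-take i xs) (m≤n⇒m⊓n≡m i≤))
  top : take i (ms ++ drop i xs) ≡ ms
  top = subst (λ k → take k (ms ++ drop i xs) ≡ ms) len (take-length-++ ms (drop i xs))
  rest : drop i (ms ++ drop i xs) ≡ drop i xs
  rest = subst (λ k → drop k (ms ++ drop i xs) ≡ drop i xs) len (drop-length-++ ms (drop i xs))

applyFlips-++ : ∀ fs gs (xs : List (Pancake n)) → applyFlips (fs ++ gs) xs ≡ applyFlips gs (applyFlips fs xs)
applyFlips-++ []       gs xs = refl
applyFlips-++ (j ∷ fs) gs xs = applyFlips-++ fs gs (flipTop (suc (toℕ j)) xs)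

-- Each flip is its own inverse. This turns a sorting sequence into one of the same length that
-- builds the stack from the sorted one.
applyFlips-reverse : ∀ fs (xs : List (Pancake n)) → length xs ≡ n →
  applyFlips (reverse fs) (applyFlips fs xs) ≡ xs
applyFlips-reverse []       xs len = refl
applyFlips-reverse {n} (j ∷ fs) xs len = trans (cong (λ gs → applyFlips gs (applyFlips fs ys)) (unfold-reverse j fs))
  (trans (applyFlips-++ (reverse fs) [ j ] (applyFlips fs ys))
    (trans (cong (flipTop i) (applyFlips-reverse fs ys (trans (length-flipTop i xs) len)))
           (flipTop-involutive i xs (subst (i ≤_) (sym len) (toℕ<n j)))))
  where
  i = suc (toℕ j)
  ys = flipTop i xs

-- The effect of a flip on bonds.

adjacent≤1 : ∀ (x y : Pancake n) → adjacent x y ≤ 1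
adjacent≤1 (p , false) (q , false) = ⟦⟧≤1 (suc (toℕ p) ≡ᵇ toℕ q)
adjacent≤1 (p , false) (q , true)  = z≤n
adjacent≤1 (p , true)  (q , false) = z≤n
adjacent≤1 (p , true)  (q , true)  = ⟦⟧≤1 (suc (toℕ q) ≡ᵇ toℕ p)

-- `turn` exchanges the two bonding clauses of `adjacent`, so a bond turned over is still a bond.
adjacent-turn : ∀ (x y : Pancake n) → adjacent (turn y) (turn x) ≡ adjacent x y
adjacent-turn (p , false) (q , false) = refl
adjacent-turn (p , false) (q , true)  = refl
adjacent-turn (p , true)  (q , false) = refl
adjacent-turn (p , true)  (q , true)  = refl

bondOnto≤1 : ∀ (x : Pancake n) ys → bondOnto x ys ≤ 1
bondOnto≤1 x []      = z≤n
bondOnto≤1 x (y ∷ _) = adjacent≤1 x y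

bonds≤length : ∀ (xs : List (Pancake n)) → bonds xs ≤ length xs
bonds≤length []       = z≤n
bonds≤length (x ∷ xs) = +-mono-≤ (bondOnto≤1 x xs) (bonds≤length xs)

bonds-∷ʳ : ∀ (us : List (Pancake n)) y x → bonds ((us ∷ʳ y) ∷ʳ x) ≡ bonds (us ∷ʳ y) + adjacent y x
bonds-∷ʳ []           y x = +-identityʳ _
bonds-∷ʳ (u ∷ [])     y x = trans (cong (adjacent u y +_) (bonds-∷ʳ [] y x)) (sym (+-assoc (adjacent u y) 0 _))
bonds-∷ʳ (u ∷ v ∷ us) y x = trans (cong (adjacent u v +_) (bonds-∷ʳ (v ∷ us) y x)) (sym (+-assoc (adjacent u v) _ _))

bonds-mirror : ∀ (us : List (Pancake n)) → bonds (mirror us) ≡ bonds us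
bonds-mirror []           = refl
bonds-mirror (x ∷ [])     = refl
bonds-mirror (x ∷ y ∷ us) = begin-equality
  bonds (mirror (x ∷ y ∷ us))                   ≡⟨ cong bonds (mirror-∷ x (y ∷ us)) ⟩
  bonds (mirror (y ∷ us) ∷ʳ turn x)             ≡⟨ cong (λ vs → bonds (vs ∷ʳ turn x)) (mirror-∷ y us) ⟩
  bonds ((mirror us ∷ʳ turn y) ∷ʳ turn x)       ≡⟨ bonds-∷ʳ (mirror us) (turn y) (turn x) ⟩
  bonds (mirror us ∷ʳ turn y) + adjacent (turn y) (turn x)
    ≡⟨ cong₂ _+_ (trans (cong bonds (sym (mirror-∷ y us))) (bonds-mirror (y ∷ us))) (adjacent-turn x y) ⟩
  bonds (y ∷ us) + adjacent x y                 ≡⟨ +-comm (bonds (y ∷ us)) (adjacent x y) ⟩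
  bonds (x ∷ y ∷ us)                            ∎
  where open ≤-Reasoning

bonds-++-≥ : ∀ (us vs : List (Pancake n)) → bonds us + bonds vs ≤ bonds (us ++ vs)
bonds-++-≥ []           vs = ≤-refl
bonds-++-≥ (x ∷ [])     vs = m≤n+m (bonds vs) (bondOnto x vs)
bonds-++-≥ (x ∷ y ∷ us) vs = ≤-trans (≤-reflexive (+-assoc (adjacent x y) _ _))
  (+-monoʳ-≤ (adjacent x y) (bonds-++-≥ (y ∷ us) vs))

bonds-++-≤ : ∀ (us vs : List (Pancake n)) → bonds (us ++ vs) ≤ suc (bonds us + bonds vs)
bonds-++-≤ []           vs = n≤1+n _
bonds-++-≤ (x ∷ [])     vs = +-monoˡ-≤ (bonds vs) (bondOnto≤1 x vs)
bonds-++-≤ (x ∷ y ∷ us) vs = ≤-trans (+-monoʳ-≤ (adjacent x y) (bonds-++-≤ (y ∷ us) vs))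
  (≤-reflexive (trans (+-suc (adjacent x y) _) (cong suc (sym (+-assoc (adjacent x y) _ _)))))

-- Index `i` is the pair that a flip of the top `suc i` pancakes separates; from the bottom pancake
-- on, the value is 0.
bondAt : ℕ → List (Pancake n) → ℕ
bondAt i       []       = 0
bondAt zero    (x ∷ xs) = bondOnto x xs
bondAt (suc i) (x ∷ xs) = bondAt i xs

bondAt≤1 : ∀ i (xs : List (Pancake n)) → bondAt i xs ≤ 1
bondAt≤1 i       []       = z≤n
bondAt≤1 zero    (x ∷ xs) = bondOnto≤1 x xs
bondAt≤1 (suc i) (x ∷ xs) = bondAt≤1 i xs

-- Different flips cut at different pairs, so at most `bonds xs` flips can destroy a bond. This is
-- the source of the factorial in `length-within`.
∑-bondAt : ∀ k (xs : List (Pancake n)) → ∑ (allFin k) (λ j → bondAt (toℕ j) xs) ≤ bonds xs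
∑-bondAt zero    xs       = z≤n
∑-bondAt (suc k) []       = ≤-reflexive (∑-zero (allFin (suc k)))
∑-bondAt (suc k) (x ∷ xs) = ≤-trans (≤-reflexive (∑-allFin-suc k (λ j → bondAt (toℕ j) (x ∷ xs))))
  (+-monoʳ-≤ (bondOnto x xs) (∑-bondAt k xs))

bonds-split : ∀ i (xs : List (Pancake n)) →
  bonds xs ≡ bonds (take (suc i) xs) + bonds (drop (suc i) xs) + bondAt i xs
bonds-split i       []           = refl
bonds-split zero    (x ∷ xs)     = +-comm (bondOnto x xs) (bonds xs)
bonds-split (suc i) (x ∷ [])     = refl
bonds-split (suc i) (x ∷ y ∷ xs) = trans (cong (adjacent x y +_) (bonds-split i (y ∷ xs)))
  (regroup (adjacent x y) (bonds (take (suc i) (y ∷ xs))) (bonds (drop i xs)) (bondAt i (y ∷ xs)))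
  where
  regroup : ∀ a b c d → a + (b + c + d) ≡ a + b + c + d
  regroup = solve-∀

-- Bonds inside the turned prefix and inside the rest are kept; only the pair at the cut changes.
bonds-flipTop-≤ : ∀ i (xs : List (Pancake n)) → bonds (flipTop (suc i) xs) ≤ suc (bonds xs)
bonds-flipTop-≤ i xs = begin
  bonds (flipTop (suc i) xs)                                     ≤⟨ bonds-++-≤ (mirror (take (suc i) xs)) (drop (suc i) xs) ⟩
  suc (bonds (mirror (take (suc i) xs)) + bonds (drop (suc i) xs)) ≡⟨ cong (λ t → suc (t + bonds (drop (suc i) xs))) (bonds-mirror (take (suc i) xs)) ⟩
  suc (bonds (take (suc i) xs) + bonds (drop (suc i) xs))        ≤⟨ s≤s (m≤m+n _ (bondAt i xs)) ⟩
  suc (bonds (take (suc i) xs) + bonds (drop (suc i) xs) + bondAt i xs) ≡⟨ cong suc (sym (bonds-split i xs)) ⟩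
  suc (bonds xs)                                                 ∎
  where open ≤-Reasoning

-- Having `bondAt i xs` in place of 1 records that a bond is lost only where the flip cuts one.
bonds-flipTop-≥ : ∀ i (xs : List (Pancake n)) → bonds xs ≤ bonds (flipTop (suc i) xs) + bondAt i xs
bonds-flipTop-≥ i xs = begin
  bonds xs                                                                 ≡⟨ bonds-split i xs ⟩
  bonds (take (suc i) xs) + bonds (drop (suc i) xs) + bondAt i xs          ≡⟨ cong (λ t → t + bonds (drop (suc i) xs) + bondAt i xs) (sym (bonds-mirror (take (suc i) xs))) ⟩
  bonds (mirror (take (suc i) xs)) + bonds (drop (suc i) xs) + bondAt i xs ≤⟨ +-monoˡ-≤ (bondAt i xs) (bonds-++-≥ (mirror (take (suc i) xs)) (drop (suc i) xs)) ⟩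
  bonds (flipTop (suc i) xs) + bondAt i xs                                 ∎
  where open ≤-Reasoning

bonds-applyFlips : ∀ gs (xs : List (Pancake n)) → bonds xs ≤ length gs + bonds (applyFlips gs xs)
bonds-applyFlips []       xs = ≤-refl
bonds-applyFlips (j ∷ gs) xs = begin
  bonds xs                                         ≤⟨ bonds-flipTop-≥ (toℕ j) xs ⟩
  bonds (flipTop (suc (toℕ j)) xs) + bondAt (toℕ j) xs ≤⟨ +-mono-≤ (bonds-applyFlips gs _) (bondAt≤1 (toℕ j) xs) ⟩
  length gs + bonds (applyFlips (j ∷ gs) xs) + 1   ≡⟨ +-comm _ 1 ⟩
  length (j ∷ gs) + bonds (applyFlips (j ∷ gs) xs) ∎
  where open ≤-Reasoning

bonds-tabulate : ∀ m (f : Fin (suc m) → Pancake n) → (∀ i → adjacent (f (inject₁ i)) (f (suc i)) ≡ 1) →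
  bonds (toList (tabulate f)) ≡ m
bonds-tabulate zero    f adj = refl
bonds-tabulate (suc m) f adj = cong₂ _+_ (adj zero) (bonds-tabulate m (f ∘ suc) (adj ∘ suc))

bonds-identityStack : ∀ m → bonds (toList (identityStack (suc m))) ≡ m
bonds-identityStack m = bonds-tabulate m (λ i → i , false) consecutive
  where
  ≡ᵇ-refl : ∀ k → (k ≡ᵇ k) ≡ true
  ≡ᵇ-refl zero    = refl
  ≡ᵇ-refl (suc k) = ≡ᵇ-refl k
  consecutive : ∀ (i : Fin m) → ⟦ toℕ (inject₁ i) ≡ᵇ toℕ i ⟧ ≡ 1
  consecutive i rewrite toℕ-inject₁ i = cong ⟦_⟧ (≡ᵇ-refl (toℕ i))

-- Counting the stacks reachable with bounded waste.

-- The stacks reachable from xs by a sequence of flips for which the number of flips plus the number of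
-- bonds of the final stack is at most e.  Stacks with more than e bonds are cut off: a flip destroys at most one bond.
within : ℕ → List (Pancake n) → List (List (Pancake n))
within     zero    xs = if bonds xs ≤ᵇ 0 then [ xs ] else []
within {n} (suc e) xs =
  if bonds xs ≤ᵇ suc e
  then xs ∷ concatMap (λ j → within e (flipTop (suc (toℕ j)) xs)) (allFin n)
  else []

-- By `bonds-applyFlips`, every intermediate stack has at most as many bonds as the remaining
-- budget, so the cut-off never discards it.
applyFlips∈within : ∀ e gs (xs : List (Pancake n)) →
  length gs + bonds (applyFlips gs xs) ≤ e → applyFlips gs xs ∈ within e xs
applyFlips∈within zero [] xs le rewrite dec-true (bonds xs ≤? 0) le = here refl
applyFlips∈within (suc e) [] xs le rewrite dec-true (bonds xs ≤? suc e) le = here refl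
applyFlips∈within {n} (suc e) (j ∷ gs) xs le
  rewrite dec-true (bonds xs ≤? suc e) (≤-trans (bonds-applyFlips (j ∷ gs) xs) le) =
  there (∈-concatMap⁺ (λ j → within e (flipTop (suc (toℕ j)) xs))
    (lose (∈-allFin j) (applyFlips∈within e gs (flipTop (suc (toℕ j)) xs) (s≤s⁻¹ le))))

-- The inductive step of `length-within` for one flip: `L` counts the stacks listed after it, `E` is
-- `B ^ e`, and `a`, `a'` are the bonds before and after. The first summand pays for a flip that
-- destroys a bond; the second, without the factor `B`, for any other.
flip-weight : ∀ {B E L b} a a' → b ≤ 1 → a ≤ a' + b → a' ≤ suc a → suc (suc a) ≤ B →
  L * B ^ a' ≤ 2 * suc a' ! * E → L * B ^ a ≤ b * (2 * a ! * (B * E)) + 2 * suc a ! * E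
flip-weight {B} {E} {L} {b} a a' b≤1 a≤ a'≤ a+2≤B le with m≤n⇒m<n∨m≡n a'≤
-- A bond is gained: the exponent of `B` rises by one, and this extra `B` absorbs the new factor
-- `a + 2` of the factorial.
... | inj₂ refl = ≤-trans (*-cancelˡ-≤ B {{>-nonZero (≤-trans (s≤s z≤n) a+2≤B)}} (begin
  B * (L * B ^ a)                        ≡⟨ *-swapˡ B L (B ^ a) ⟩
  L * B ^ suc a                          ≤⟨ le ⟩
  2 * (suc (suc a) * suc a !) * E        ≡⟨ regroup (suc (suc a)) (suc a !) E ⟩
  suc (suc a) * (2 * suc a ! * E)        ≤⟨ *-monoˡ-≤ (2 * suc a ! * E) a+2≤B ⟩
  B * (2 * suc a ! * E)                  ∎)) (m≤n+m _ _)
  where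
  open ≤-Reasoning
  regroup : ∀ s f e → 2 * (s * f) * e ≡ s * (2 * f * e)
  regroup = solve-∀
... | inj₁ (s≤s a'≤a) with m≤n⇒m<n∨m≡n a'≤a
...   | inj₂ refl = ≤-trans le (m≤n+m _ _)
...   | inj₁ a'<a with b | b≤1
...     | zero        | _ = contradiction (≤-trans a≤ (≤-reflexive (+-identityʳ a'))) (<⇒≱ a'<a)
...     | suc (suc _) | s≤s ()
...     | suc zero    | _ with ≤-antisym a'<a (≤-trans a≤ (≤-reflexive (+-comm a' 1)))
-- A bond is destroyed: `a` is `suc a'`, so the inductive bound already carries `a !`, and `b` is 1.
...       | refl = ≤-trans (begin
  L * B ^ suc a'             ≡⟨ *-swapˡ L B (B ^ a') ⟩
  B * (L * B ^ a')           ≤⟨ *-monoʳ-≤ B le ⟩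
  B * (2 * suc a' ! * E)     ≡⟨ regroup B (suc a' !) E ⟩
  1 * (2 * suc a' ! * (B * E)) ∎) (m≤m+n _ _)
  where
  open ≤-Reasoning
  regroup : ∀ b f e → b * (2 * f * e) ≡ 1 * (2 * f * (b * e))
  regroup = solve-∀

module _ {n B : ℕ} (1≤n : 1 ≤ n) (2n[1+n]≤B : 2 * n * suc n ≤ B) where

  private
    n+2≤B : suc (suc n) ≤ B
    n+2≤B = begin
      suc (suc n)    ≤⟨ s≤s (s≤s (m≤m+n n n)) ⟩
      2 + (n + n)    ≡⟨ regroup n ⟩
      2 * 1 * suc n  ≤⟨ *-monoˡ-≤ (suc n) (*-monoʳ-≤ 2 1≤n) ⟩
      2 * n * suc n  ≤⟨ 2n[1+n]≤B ⟩
      B              ∎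
      where
      open ≤-Reasoning
      regroup : ∀ n → 2 + (n + n) ≡ 2 * 1 * suc n
      regroup = solve-∀

    instance
      B≢0 : NonZero B
      B≢0 = >-nonZero (≤-trans (s≤s z≤n) n+2≤B)

  -- A flip that destroys a bond can be chosen in at most (bonds xs) ways, which accounts for the factorial;
  -- any other flip wastes a factor B, which outweighs the number n of its choices.
  length-within : ∀ e (xs : List (Pancake n)) → length xs ≡ n →
    length (within e xs) * B ^ bonds xs ≤ 2 * suc (bonds xs) ! * B ^ e
  length-within zero xs len with bonds xs
  ... | zero  = s≤s z≤n
  ... | suc _ = z≤n
  length-within (suc e) xs len with bonds xs ≤ᵇ suc e | ≤ᵇ⇒≤ (bonds xs) (suc e)
  ... | false | _   = z≤n
  ... | true  | a≤e = begin
    (1 + length (concatMap next (allFin n))) * B ^ a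
      ≡⟨ cong (λ t → (1 + t) * B ^ a) (length-concatMap next (allFin n)) ⟩
    (1 + ∑ (allFin n) (length ∘ next)) * B ^ a
      ≡⟨ *-distribʳ-+ (B ^ a) 1 (∑ (allFin n) (length ∘ next)) ⟩
    1 * B ^ a + ∑ (allFin n) (length ∘ next) * B ^ a
      ≡⟨ cong₂ _+_ (*-identityˡ (B ^ a)) (sym (∑-*ʳ (allFin n) (length ∘ next) (B ^ a))) ⟩
    B ^ a + ∑ (allFin n) (λ j → length (next j) * B ^ a)
      -- The lone `B ^ a` stands for `xs` itself, with no flip made; the cut-off gives `a ≤ suc e`.
      ≤⟨ +-mono-≤ (^-monoʳ-≤ B (a≤e _)) (∑-mono (allFin n) step) ⟩
    B ^ suc e + ∑ (allFin n) (λ j → bondAt (toℕ j) xs * X + Y)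
      ≡⟨ cong (B ^ suc e +_) (trans (∑-+ (allFin n) _ _) (cong₂ _+_ (∑-*ʳ (allFin n) _ X) (∑-allFin-const n Y))) ⟩
    B ^ suc e + (∑ (allFin n) (λ j → bondAt (toℕ j) xs) * X + n * Y)
      ≤⟨ +-monoʳ-≤ (B ^ suc e) (+-monoˡ-≤ (n * Y) (*-monoˡ-≤ X (∑-bondAt n xs))) ⟩
    B * E + (a * X + n * Y)
      ≡⟨ regroup₁ B E (a * X) n (suc a) (a !) ⟩
    (B * 1 + 2 * n * suc a * a !) * E + a * X
      -- The leading 2 of the bound is spent here: one `B * a !` covers the empty sequence, the
      -- other the `n` flips charged `Y`. Together with the `a` bond-destroying flips they turn
      -- `a !` into `suc a !`.
      ≤⟨ +-monoˡ-≤ (a * X) (*-monoˡ-≤ E (+-mono-≤ (*-monoʳ-≤ B (1≤n! a)) (*-monoˡ-≤ (a !) 2n[1+a]≤B))) ⟩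
    (B * a ! + B * a !) * E + a * X
      ≡⟨ regroup₂ B (a !) E a ⟩
    2 * suc a ! * (B * E) ∎
    where
    open ≤-Reasoning
    a = bonds xs
    E = B ^ e
    X = 2 * a ! * (B * E)
    Y = 2 * suc a ! * E
    next : Fin n → List (List (Pancake n))
    next j = within e (flipTop (suc (toℕ j)) xs)
    a≤n : a ≤ n
    a≤n = subst (a ≤_) len (bonds≤length xs)
    2n[1+a]≤B : 2 * n * suc a ≤ B
    2n[1+a]≤B = ≤-trans (*-monoʳ-≤ (2 * n) (s≤s a≤n)) 2n[1+n]≤B
    step : ∀ j → length (next j) * B ^ a ≤ bondAt (toℕ j) xs * X + Y
    step j = flip-weight {B} {E} {length (next j)} a (bonds ys) (bondAt≤1 (toℕ j) xs) (bonds-flipTop-≥ (toℕ j) xs)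
      (bonds-flipTop-≤ (toℕ j) xs) (≤-trans (s≤s (s≤s a≤n)) n+2≤B)
      (length-within e ys (trans (length-flipTop (suc (toℕ j)) xs) len))
      where ys = flipTop (suc (toℕ j)) xs
    regroup₁ : ∀ b e x n s f → b * e + (x + n * (2 * (s * f) * e)) ≡ (b * 1 + 2 * n * s * f) * e + x
    regroup₁ = solve-∀
    regroup₂ : ∀ b f e a → (b * f + b * f) * e + a * (2 * f * (b * e)) ≡ 2 * (f + a * f) * (b * e)
    regroup₂ = solve-∀

-- From the count to a bound on the total number of flips.

samePancake : Pancake n → Pancake n → ℕ
samePancake (i , a) (j , b) = ⟦ does (i ≟ j) ⟧ * ⟦ does (a Bool.≟ b) ⟧

samePancake-refl : ∀ (p : Pancake n) → samePancake p p ≡ 1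
samePancake-refl (i , a) rewrite dec-true (i ≟ i) refl | dec-true (a Bool.≟ a) refl = refl

∑-samePancake : ∀ (q : Pancake n) → ∑ (pancakes n) (λ p → samePancake p q) ≡ 1
∑-samePancake {n} q@(j , true)  = trans (∑-pancakes (λ p → samePancake p q))
  (trans (∑-cong (allFin n) (λ i → only ⟦ does (i ≟ j) ⟧)) (∑-allFin-≟ j))
  where
  only : ∀ x → x * 1 + x * 0 ≡ x
  only = solve-∀
∑-samePancake {n} q@(j , false) = trans (∑-pancakes (λ p → samePancake p q))
  (trans (∑-cong (allFin n) (λ i → only ⟦ does (i ≟ j) ⟧)) (∑-allFin-≟ j))
  where
  only : ∀ x → x * 0 + x * 1 ≡ x
  only = solve-∀

-- A 0/1-valued equality test of a vector with a plain list of any length, the form in which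
-- `within` yields its stacks.
matches : ∀ {k} → Vec (Pancake n) k → List (Pancake n) → ℕ
matches V.[]      []       = 1
matches V.[]      (y ∷ ys) = 0
matches (x V.∷ v) []       = 0
matches (x V.∷ v) (y ∷ ys) = samePancake x y * matches v ys

matches-toList : ∀ {k} (v : Vec (Pancake n) k) → matches v (toList v) ≡ 1
matches-toList V.[]      = refl
matches-toList (x V.∷ v) = cong₂ _*_ (samePancake-refl x) (matches-toList v)

-- A list of length other than `k` matches nothing, hence `≤`. So each entry of `within` accounts
-- for at most one stack, and repeated entries do no harm.
∑-matches : ∀ k (ys : List (Pancake n)) → ∑ (allVecs (pancakes n) k) (λ v → matches v ys) ≤ 1
∑-matches zero    []       = ≤-refl
∑-matches zero    (y ∷ ys) = z≤n
∑-matches {n} (suc k) []   = ≤-trans (≤-reflexive (trans (∑-allVecs-suc (pancakes n) k _)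
  (trans (∑-cong (pancakes n) (λ _ → ∑-zero (allVecs (pancakes n) k))) (∑-zero (pancakes n))))) z≤n
∑-matches {n} (suc k) (y ∷ ys) = begin
  ∑ (allVecs P (suc k)) (λ v → matches v (y ∷ ys))                     ≡⟨ ∑-allVecs-suc P k _ ⟩
  ∑ P (λ x → ∑ (allVecs P k) (λ v → samePancake x y * matches v ys))   ≡⟨ ∑-cong P (λ x → ∑-*ˡ (allVecs P k) (samePancake x y) _) ⟩
  ∑ P (λ x → samePancake x y * ∑ (allVecs P k) (λ v → matches v ys))   ≤⟨ ∑-mono P (λ x → *-monoʳ-≤ (samePancake x y) (∑-matches k ys)) ⟩
  ∑ P (λ x → samePancake x y * 1)                                      ≡⟨ ∑-*ʳ P _ 1 ⟩
  ∑ P (λ x → samePancake x y) * 1                                      ≡⟨ cong (_* 1) (∑-samePancake y) ⟩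
  1                                                                    ∎
  where
  open ≤-Reasoning
  P = pancakes n

sortable⇒reachable : ∀ k (C : Stack n) → SortableIn k C →
  ∃ λ gs → (length gs ≡ k) × (applyFlips gs (toList (identityStack n)) ≡ toList C)
sortable⇒reachable k C (fs , len , sorted) = reverse fs , trans (length-reverse fs) len ,
  trans (cong (applyFlips (reverse fs)) (sym sorted)) (applyFlips-reverse fs (toList C) (length-toList C))

-- If the waste exceeds `j`, flips and bonds alone give the bound. Otherwise they still give `m`,
-- the number of bonds of the sorted stack, and `C` occurs in the list, so the last summand supplies
-- `suc j`.
stack-cost : ∀ m j k (C : Stack (suc m)) → SortableIn k C →
  m + suc j ≤ k + bonds (toList C) + suc j * ∑ (within (m + j) (toList (identityStack (suc m)))) (matches C)
stack-cost m j k C sortable with sortable⇒reachable k C sortable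
... | gs , refl , reached with length gs + bonds (toList C) ≤? m + j
...   | no  k≰ = ≤-trans (≤-trans (≤-reflexive (+-suc m j)) (≰⇒> k≰)) (m≤m+n _ _)
...   | yes k≤ = +-mono-≤ m≤ (≤-trans (≤-reflexive (sym (*-identityʳ (suc j)))) (*-monoʳ-≤ (suc j) found))
  where
  I = toList (identityStack (suc m))
  m≤ : m ≤ length gs + bonds (toList C)
  m≤ = subst₂ (λ a xs → a ≤ length gs + bonds xs) (bonds-identityStack m) reached (bonds-applyFlips gs I)
  C∈ : toList C ∈ within (m + j) I
  C∈ = subst (_∈ within (m + j) I) reached
    (applyFlips∈within (m + j) gs I (subst (λ xs → length gs + bonds xs ≤ m + j) (sym reached) k≤))
  found : 1 ≤ ∑ (within (m + j) I) (matches C)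
  found = ≤-trans (≤-reflexive (sym (matches-toList C))) (∑-∈ (matches C) C∈)

-- Choice of the waste threshold and the final estimate.

crossing : ∀ {X} (f : ℕ → ℕ) k → f 0 ≤ X → X < f k → ∃ λ j → (f j ≤ X) × (X < f (suc j))
crossing f zero    f0≤X X<f0 = contradiction f0≤X (<⇒≱ X<f0)
crossing {X} f (suc k) f0≤X X<fk with f k ≤? X
... | yes fk≤X = k , fk≤X , X<fk
... | no  fk≰X = crossing f k f0≤X (≰⇒> fk≰X)

-- The first inequality makes the stacks of waste at most `j` no more than half of all; the second
-- makes `suc j` of order n / log n.
power-crossing : ∀ n → 16 ≤ n → ∃ λ j → (4 * (n ^ 4) ^ j ≤ 2 ^ n) × (2 ^ n < 4 * (n ^ 4) ^ suc j)
power-crossing n@(suc _) 16≤n = crossing (λ j → 4 * (n ^ 4) ^ j) n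
  (^-monoʳ-≤ 2 (≤-trans (m≤m+n 2 14) 16≤n))
  (begin-strict
    2 ^ n            ≤⟨ ^-monoˡ-≤ n 2≤n^4 ⟩
    (n ^ 4) ^ n      <⟨ m<m*n ((n ^ 4) ^ n) 4 {{m^n≢0 (n ^ 4) n {{m^n≢0 n 4}}}} (m≤m+n 2 2) ⟩
    (n ^ 4) ^ n * 4  ≡⟨ *-comm ((n ^ 4) ^ n) 4 ⟩
    4 * (n ^ 4) ^ n  ∎)
  where
  open ≤-Reasoning
  2≤n^4 : 2 ≤ n ^ 4
  2≤n^4 = ≤-trans (≤-trans (m≤m+n 2 14) 16≤n) (m≤m*n n (n ^ 3) {{m^n≢0 n 3}})

-- Shows that `B = n ^ 4` is admissible in `length-within`.
2n[1+n]≤n^4 : ∀ n → 2 ≤ n → 2 * n * suc n ≤ n ^ 4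
2n[1+n]≤n^4 n 2≤n = begin
  2 * n * suc n    ≤⟨ *-mono-≤ (*-monoˡ-≤ n 2≤n) 1+n≤n*n ⟩
  n * n * (n * n)  ≡⟨ regroup n ⟩
  n ^ 4            ∎
  where
  open ≤-Reasoning
  regroup : ∀ n → n * n * (n * n) ≡ n * (n * (n * (n * 1)))
  regroup = solve-∀
  1+n≤n*n : suc n ≤ n * n
  1+n≤n*n = begin
    1 + n  ≤⟨ +-monoˡ-≤ n (≤-trans (n≤1+n 1) 2≤n) ⟩
    n + n  ≡⟨ cong (n +_) (sym (+-identityʳ n)) ⟩
    2 * n  ≤⟨ *-monoˡ-≤ n 2≤n ⟩
    n * n  ∎

-- Squaring `upper` doubles the exponent 4 to 8 and produces a factor 16, which one of the two
-- factors `2 ^ n` absorbs. The conclusion reads k ≥ n / (8 log₂ n).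
2^n≤n^8k : ∀ n k → 4 ≤ n → 2 ^ n < 4 * (n ^ 4) ^ k → 2 ^ n ≤ n ^ (8 * k)
2^n≤n^8k n k 4≤n upper = *-cancelˡ-≤ 16 (begin
  2 ^ 4 * 2 ^ n                            ≤⟨ *-monoˡ-≤ (2 ^ n) (^-monoʳ-≤ 2 4≤n) ⟩
  2 ^ n * 2 ^ n                            ≤⟨ *-mono-≤ (<⇒≤ upper) (<⇒≤ upper) ⟩
  4 * (n ^ 4) ^ k * (4 * (n ^ 4) ^ k)      ≡⟨ regroup ((n ^ 4) ^ k) ⟩
  16 * ((n ^ 4) ^ k * (n ^ 4) ^ k)         ≡⟨ cong (λ t → 16 * (t * t)) (^-*-assoc n 4 k) ⟩
  16 * (n ^ (4 * k) * n ^ (4 * k))         ≡⟨ cong (16 *_) (sym (^-distribˡ-+-* n (4 * k) (4 * k))) ⟩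
  16 * n ^ (4 * k + 4 * k)                 ≡⟨ cong (λ t → 16 * n ^ t) (sym (*-distribʳ-+ k 4 4)) ⟩
  16 * n ^ (8 * k)                         ∎)
  where
  open ≤-Reasoning
  regroup : ∀ t → 4 * t * (4 * t) ≡ 16 * (t * t)
  regroup = solve-∀

-- The sorted stack has `m` bonds, so `length-within` gives the factorial of `suc m` and `B ^ m`
-- cancels, leaving only `B ^ j`.
length-within-identityStack : ∀ m j → 2 ≤ suc m → 4 * (suc m ^ 4) ^ j ≤ 2 ^ suc m →
  2 * length (within (m + j) (toList (identityStack (suc m)))) ≤ suc m ! * 2 ^ suc m
length-within-identityStack m j 2≤n lower = begin
  2 * length R                  ≤⟨ *-monoʳ-≤ 2 (*-cancelʳ-≤ (length R) (2 * suc m ! * B ^ j) (B ^ m) {{m^n≢0 B m {{m^n≢0 n′ 4}}}} bound) ⟩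
  2 * (2 * n′ ! * B ^ j)         ≡⟨ regroup (n′ !) (B ^ j) ⟩
  n′ ! * (4 * B ^ j)             ≤⟨ *-monoʳ-≤ (n′ !) lower ⟩
  n′ ! * 2 ^ n′                   ∎
  where
  open ≤-Reasoning
  n′ = suc m
  B = n′ ^ 4
  R = within (m + j) (toList (identityStack n′))
  regroup : ∀ f t → 2 * (2 * f * t) ≡ f * (4 * t)
  regroup = solve-∀
  shift : ∀ f → f * B ^ (m + j) ≡ f * B ^ j * B ^ m
  shift f = trans (cong (f *_) (trans (^-distribˡ-+-* B m j) (*-comm (B ^ m) (B ^ j)))) (sym (*-assoc f (B ^ j) (B ^ m)))
  bound : length R * B ^ m ≤ 2 * n′ ! * B ^ j * B ^ m
  bound = ≤-trans
    (subst (λ a → length R * B ^ a ≤ 2 * suc a ! * B ^ (m + j)) (bonds-identityStack m)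
      (length-within (s≤s z≤n) (2n[1+n]≤n^4 n′ 2≤n) (m + j) _ (length-toList (identityStack n′))))
    (≤-reflexive (shift (2 * n′ !)))

totalFlips-≥ : ∀ m j (g : Stack (suc m) → ℕ) → IsOptimalFlipCount (suc m) g →
  (m + suc j) * (suc m ! * 2 ^ suc m)
  ≤ totalFlips (suc m) g + totalBonds (suc m) (suc m)
    + suc j * length (within (m + j) (toList (identityStack (suc m))))
totalFlips-≥ m j g opt = begin
  (m + suc j) * (n′ ! * 2 ^ n′)
    ≡⟨ *-comm (m + suc j) (n′ ! * 2 ^ n′) ⟩
  n′ ! * 2 ^ n′ * (m + suc j)
    ≡⟨ cong (_* (m + suc j)) (sym (trans (∑-distinct n′ 0 (+-identityʳ n′)) (extensions-zero n′))) ⟩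
  ∑ Vs δ * (m + suc j)
    ≡⟨ sym (∑-*ʳ Vs δ (m + suc j)) ⟩
  ∑ Vs (λ C → δ C * (m + suc j))
    ≤⟨ ∑-mono Vs (λ C → ⟦⟧*-mono-≤ (distinct (toList C)) (λ d → stack-cost m j (g C) C (proj₁ (opt C d)))) ⟩
  ∑ Vs (λ C → δ C * (g C + bonds (toList C) + suc j * hits C))
    -- The indicator is dropped from the `hits` term, so that `∑-matches` applies to the sum over
    -- all vectors.
    ≤⟨ ∑-mono Vs split ⟩
  ∑ Vs (λ C → δ C * g C + δ C * bonds (toList C) + suc j * hits C)
    ≡⟨ ∑-+ Vs (λ C → δ C * g C + δ C * bonds (toList C)) (λ C → suc j * hits C) ⟩
  ∑ Vs (λ C → δ C * g C + δ C * bonds (toList C)) + ∑ Vs (λ C → suc j * hits C)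
    ≡⟨ cong₂ _+_ (∑-+ Vs (λ C → δ C * g C) (λ C → δ C * bonds (toList C))) (∑-*ˡ Vs (suc j) hits) ⟩
  ∑ Vs (λ C → δ C * g C) + totalBonds n′ n′ + suc j * ∑ Vs hits
    ≤⟨ +-mono-≤ (≤-reflexive (cong (_+ totalBonds n′ n′) (sym (∑-filterᵇ (λ C → distinct (toList C)) Vs g))))
                (*-monoʳ-≤ (suc j) total-hits) ⟩
  totalFlips n′ g + totalBonds n′ n′ + suc j * length R ∎
  where
  open ≤-Reasoning
  n′ = suc m
  Vs = allVecs (pancakes n′) n′
  R = within (m + j) (toList (identityStack n′))
  δ hits : Stack n′ → ℕ
  δ C = ⟦ distinct (toList C) ⟧
  hits C = ∑ R (matches C)
  split : ∀ C → δ C * (g C + bonds (toList C) + suc j * hits C)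
              ≤ δ C * g C + δ C * bonds (toList C) + suc j * hits C
  split C = ≤-trans (≤-reflexive (trans (*-distribˡ-+ (δ C) (g C + bonds (toList C)) (suc j * hits C))
      (cong (_+ δ C * (suc j * hits C)) (*-distribˡ-+ (δ C) (g C) (bonds (toList C))))))
    (+-monoʳ-≤ (δ C * g C + δ C * bonds (toList C)) (⟦⟧*-≤ (distinct (toList C)) (suc j * hits C)))
  total-hits : ∑ Vs hits ≤ length R
  total-hits = begin
    ∑ Vs (λ C → ∑ R (matches C))         ≡⟨ ∑-swap Vs R matches ⟩
    ∑ R (λ D → ∑ Vs (λ C → matches C D)) ≤⟨ ∑-mono R (∑-matches n′) ⟩
    ∑ R (λ _ → 1)                        ≡⟨ sym (length-∑ R) ⟩
    length R                             ∎

-- With N = n! 2ⁿ the hypotheses read k/2 ≥ n / (16 log₂ n) and S/N ≥ n + k/2 - 3/2. Raising the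
-- first to the power 2N brings it to the exponential form of `AvOptBound`.
AvOptBound-intro : ∀ n k S .{{_ : NonZero n}} → 2 ^ n ≤ n ^ (8 * k) →
  (2 * n + k) * (n ! * 2 ^ n) ≤ 2 * S + 3 * (n ! * 2 ^ n) → AvOptBound n S
AvOptBound-intro n k S 2^n≤ main = begin
  2 ^ (2 * n * N) * n ^ (32 * n * N)              ≡⟨ cong (λ t → 2 ^ t * n ^ (32 * n * N)) (regroup₁ n N) ⟩
  2 ^ (n * (2 * N)) * n ^ (32 * n * N)            ≡⟨ cong (_* n ^ (32 * n * N)) (sym (^-*-assoc 2 n (2 * N))) ⟩
  (2 ^ n) ^ (2 * N) * n ^ (32 * n * N)            ≤⟨ *-monoˡ-≤ (n ^ (32 * n * N)) (^-monoˡ-≤ (2 * N) 2^n≤) ⟩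
  (n ^ (8 * k)) ^ (2 * N) * n ^ (32 * n * N)      ≡⟨ cong (_* n ^ (32 * n * N)) (^-*-assoc n (8 * k) (2 * N)) ⟩
  n ^ (8 * k * (2 * N)) * n ^ (32 * n * N)        ≡⟨ sym (^-distribˡ-+-* n (8 * k * (2 * N)) (32 * n * N)) ⟩
  n ^ (8 * k * (2 * N) + 32 * n * N)              ≡⟨ cong (n ^_) (regroup₂ k N n) ⟩
  n ^ (16 * ((2 * n + k) * N))                    ≤⟨ ^-monoʳ-≤ n (*-monoʳ-≤ 16 main) ⟩
  n ^ (16 * (2 * S + 3 * N))                      ∎
  where
  open ≤-Reasoning
  N = n ! * 2 ^ n
  regroup₁ : ∀ n x → 2 * n * x ≡ n * (2 * x)
  regroup₁ = solve-∀
  regroup₂ : ∀ k x n → 8 * k * (2 * x) + 32 * n * x ≡ 16 * ((2 * n + k) * x)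
  regroup₂ = solve-∀

theorem2 : (n : ℕ) → 16 ≤ n → (g : Stack n → ℕ) → IsOptimalFlipCount n g →
    AvOptBound n (totalFlips n g)
theorem2 n@(suc m) 16≤n g opt with power-crossing (suc m) 16≤n
... | j , lower , upper =
  AvOptBound-intro n (suc j) S (2^n≤n^8k n (suc j) (≤-trans (m≤m+n 4 12) 16≤n) upper)
    -- Per stack, the average is at least (n - 1) + (j + 1), less 1/2 for bonds and (j + 1)/2 for
    -- the at most half of the stacks of small waste: n + (j + 1)/2 - 3/2. Adding `suc j * N` on
    -- both sides avoids subtraction.
    (+-cancelʳ-≤ (suc j * N) _ _ (begin
      (2 * n + suc j) * N + suc j * N           ≡⟨ regroup₁ m j N ⟩
      2 * ((m + suc j) * N) + 2 * N             ≤⟨ +-monoˡ-≤ (2 * N) (*-monoʳ-≤ 2 (totalFlips-≥ m j g opt)) ⟩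
      2 * (S + TB + suc j * r) + 2 * N          ≡⟨ regroup₂ S TB j r N ⟩
      2 * S + 2 * TB + suc j * (2 * r) + 2 * N
        ≤⟨ +-monoˡ-≤ (2 * N) (+-mono-≤ (+-monoʳ-≤ (2 * S) (2*totalBonds≤ m {{>-nonZero (≤-trans (s≤s z≤n) (s≤s⁻¹ 16≤n))}}))
             (*-monoʳ-≤ (suc j) (length-within-identityStack m j (≤-trans (m≤m+n 2 14) 16≤n) lower))) ⟩
      2 * S + N + suc j * N + 2 * N             ≡⟨ regroup₃ S N (suc j * N) ⟩
      2 * S + 3 * N + suc j * N                 ∎))
  where
  open ≤-Reasoning
  N = n ! * 2 ^ n
  S = totalFlips n g
  TB = totalBonds n n
  r = length (within (m + j) (toList (identityStack n)))
  regroup₁ : ∀ m j x → (2 * suc m + suc j) * x + suc j * x ≡ 2 * ((m + suc j) * x) + 2 * x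
  regroup₁ = solve-∀
  regroup₂ : ∀ s t j r x → 2 * (s + t + suc j * r) + 2 * x ≡ 2 * s + 2 * t + suc j * (2 * r) + 2 * x
  regroup₂ = solve-∀
  regroup₃ : ∀ s x y → 2 * s + x + y + 2 * x ≡ 2 * s + 3 * x + y
  regroup₃ = solve-∀
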